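{- Let $\tilde{G}=(\tilde{Q},\tilde{E},\tilde{\delta},\tilde{q}_0)$ be a fuzzy discrete event system with uncontrollability degrees $\tilde{E}_{uc}:\tilde{E}\to[0,1]$. Let $P\subseteq\tilde{Q}$ be a controllable fuzzy state set and let $f$ be an arbitrary fuzzy state feedback controller for $\tilde{G}$ such that $R(\tilde{G}^f)=P$. Then: 1) $\mathcal{L}_{\tilde{G}^f}$ is a controllable fuzzy language (with respect to $\mathcal{L}_{\tilde{G}}$ and $\tilde{E}_{uc}$); 2) the fuzzy supervisor $\tilde{S}:\mathrm{supp}(\mathcal{L}_{\tilde{G}})\to\mathcal{F}(\tilde{E})$ defined, for $\tilde{s}\in\mathrm{supp}(\mathcal{L}_{\tilde{G}})$ and $\tilde{a}\in\tilde{E}$, by $$\tilde{S}(\tilde{s})(\tilde{a})=\begin{cases}f(\tilde{\delta}^f(\tilde{q}_0,\tilde{s}))(\tilde{a}),&\text{if }\tilde{\delta}^f(\tilde{q}_0,\tilde{s})\text{ is defined},\\1,&\text{otherwise},\end{cases}$$ satisfies $\mathcal{L}_{\tilde{S}/\tilde{G}}=\mathcal{L}_{\tilde{G}^f}$.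
   Context: Notation: $\wedge,\vee$ denote infimum (minimum) and supremum (maximum) in $[0,1]$. $\mathcal{F}(X)$ is the set of functions $X\to[0,1]$ (fuzzy subsets of $X$), ordered pointwise by $\subseteq$; $\cap$ is pointwise minimum; $\mathrm{supp}(\mathcal{A})=\{x:\mathcal{A}(x)>0\}$. Fix $n\ge1$. $\tilde{Q}$ is the set of fuzzy states: all row vectors in $[0,1]^n$ other than the zero vector. A fuzzy event is an $n\times n$ matrix over $[0,1]$; $\tilde{E}$ is a finite set of fuzzy events; $\tilde{q}_0\in\tilde{Q}$ is the initial state. $\tilde{E}^*$ is the set of finite strings over $\tilde{E}$, with empty string $\epsilon$. The max-min composition is $(A\circ B)_{ij}=\bigvee_l(a_{il}\wedge b_{lj})$. For $\lambda\in[0,1]$ and a vector $x$, $\lambda\cdot x$ is the vector with entries $\lambda\wedge x_i$. The (partial) transition function is $\tilde{\delta}(\tilde{q},\tilde{a})=\tilde{q}\circ\tilde{a}$, undefined when $\tilde{q}\circ\tilde{a}$ is the zero vector, extended to strings by $\tilde{\delta}(\tilde{q},\epsilon)=\tilde{q}$, $\tilde{\delta}(\tilde{q},\tilde{s}\tilde{a})=\tilde{\delta}(\tilde{\delta}(\tilde{q},\tilde{s}),\tilde{a})$. Each $\tilde{a}\in\tilde{E}$ has an uncontrollability degree $\tilde{E}_{uc}(\tilde{a})\in[0,1]$. A fuzzy state feedback controller (FSFC) for $\tilde{G}$ is a map $f:\tilde{Q}\to\mathcal{F}(\tilde{E})$ with $f(\tilde{q})(\tilde{a})\ge\tilde{E}_{uc}(\tilde{a})$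 for all $\tilde{q},\tilde{a}$. The closed-loop system is $\tilde{G}^f=(\tilde{Q},\tilde{E},\tilde{\delta}^f,\tilde{q}_0)$ with $\tilde{\delta}^f(\tilde{q},\tilde{a})=f(\tilde{q})(\tilde{a})\cdot(\tilde{q}\circ\tilde{a})$, undefined when this is the zero vector, extended to strings in the same way. $R(\tilde{G}^f)$ is the set of $\tilde{q}\in\tilde{Q}$ with $\tilde{q}=\tilde{\delta}^f(\tilde{q}_0,\tilde{s})$ for some $\tilde{s}\in\tilde{E}^*$. Generated languages: $\mathcal{L}_{\tilde{G}},\mathcal{L}_{\tilde{G}^f}\in\mathcal{F}(\tilde{E}^*)$ take value $1$ at $\epsilon$, and for $\tilde{s}\ne\epsilon$, $\mathcal{L}_{\tilde{G}}(\tilde{s})$ (resp. $\mathcal{L}_{\tilde{G}^f}(\tilde{s})$) is the largest entry of the vector $\tilde{\delta}(\tilde{q}_0,\tilde{s})$ (resp. $\tilde{\delta}^f(\tilde{q}_0,\tilde{s})$), being $0$ if that state is undefined. A fuzzy language is an element $\mathcal{L}$ of $\mathcal{F}(\tilde{E}^*)$ that is either identically $0$ or satisfies $\mathcal{L}(\epsilon)=1$ and $\mathcal{L}(\tilde{s})\ge\mathcal{L}(\tilde{s}\tilde{a})$ for all $\tilde{s}\in\tilde{E}^*,\tilde{a}\in\tilde{E}$. Concatenation: $(\mathcal{L}_1\mathcal{L}_2)(\tilde{s})=\bigvee\{\mathcal{L}_1(\tilde{s}_1)\wedge\mathcal{L}_2(\tilde{s}_2):\tilde{s}_1\tilde{s}_2=\tilde{s}\}$.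 Let $\mathcal{E}_{uc}\in\mathcal{F}(\tilde{E}^*)$ equal $\tilde{E}_{uc}$ on $\tilde{E}$ and $0$ on $\tilde{E}^*\setminus\tilde{E}$. A fuzzy language $\mathcal{K}\subseteq\mathcal{L}_{\tilde{G}}$ is controllable (with respect to $\mathcal{L}_{\tilde{G}}$ and $\tilde{E}_{uc}$) if $\mathcal{K}\mathcal{E}_{uc}\cap\mathcal{L}_{\tilde{G}}\subseteq\mathcal{K}$. A fuzzy supervisor for $\tilde{G}$ is a map $\tilde{S}:\mathrm{supp}(\mathcal{L}_{\tilde{G}})\to\mathcal{F}(\tilde{E})$ with $\tilde{S}(\tilde{s})(\tilde{a})\ge\tilde{E}_{uc}(\tilde{a})$ for all $\tilde{s},\tilde{a}$. The language $\mathcal{L}_{\tilde{S}/\tilde{G}}$ is defined by $\mathcal{L}_{\tilde{S}/\tilde{G}}(\epsilon)=1$ and $\mathcal{L}_{\tilde{S}/\tilde{G}}(\tilde{s}\tilde{a})=\mathcal{L}_{\tilde{G}}(\tilde{s}\tilde{a})\wedge\tilde{S}(\tilde{s})(\tilde{a})\wedge\mathcal{L}_{\tilde{S}/\tilde{G}}(\tilde{s})$ (this is $0$ when $\tilde{s}\notin\mathrm{supp}(\mathcal{L}_{\tilde{G}})$, since then $\mathcal{L}_{\tilde{G}}(\tilde{s}\tilde{a})=0$). Controllability of a state set. Let $P\subseteq\tilde{Q}$. For $\tilde{q}\in P$ let $$\mathrm{Succ}(\tilde{q})=\{(\tilde{a},\tilde{p}):\tilde{a}\in\tilde{E},\ \tilde{p}\in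 P,\ \exists\,\alpha\in[0,1],\ \alpha\ge\tilde{E}_{uc}(\tilde{a}),\ \alpha\cdot(\tilde{q}\circ\tilde{a})=\tilde{p}\}.$$ A subset $C(\tilde{q})\subseteq\mathrm{Succ}(\tilde{q})$ is compatible if: (C1) for any $(\tilde{a}_1,\tilde{p}_1),(\tilde{a}_2,\tilde{p}_2)\in C(\tilde{q})$, $\tilde{a}_1=\tilde{a}_2$ implies $\tilde{p}_1=\tilde{p}_2$; (C2) if $\tilde{a}\in\tilde{E}$ with $\tilde{E}_{uc}(\tilde{a})>0$ and $\tilde{q}\circ\tilde{a}\ne0$, then $(\tilde{a},\tilde{p})\in C(\tilde{q})$ for some $\tilde{p}\in P$. The set $P$ is controllable if one can select for each $\tilde{q}\in P$ a compatible subset $C(\tilde{q})$ of $\mathrm{Succ}(\tilde{q})$ such that for each $\tilde{p}\in P$ there exist an integer $k\ge0$ and a sequence $(\tilde{q}_0,\tilde{a}_1,\tilde{q}_1,\ldots,\tilde{a}_k,\tilde{q}_k=\tilde{p})$, starting at the initial state $\tilde{q}_0$, with $\tilde{q}_{i-1}\in P$ and $(\tilde{a}_i,\tilde{q}_i)\in C(\tilde{q}_{i-1})$ for $i=1,\ldots,k$. -}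

module Defs where

open import Level using (0ℓ) renaming (suc to lsuc)
open import Axiom.ExcludedMiddle using (ExcludedMiddle)
open import Data.Fin.Base using (Fin)
open import Data.List.Base using (List; []; _∷_; _∷ʳ_; _++_; foldl)
open import Data.List.Reverse using (Reverse; []; _∶_∶ʳ_; reverseView)
open import Data.Maybe.Base using (Maybe; just; nothing; maybe; _>>=_)
open import Data.Maybe.Relation.Binary.Pointwise using (Pointwise)
open import Data.Nat.Base using (ℕ)
open import Data.Product.Base using (Σ; Σ-syntax; ∃; ∃-syntax; _×_; _,_; proj₁; proj₂)
open import Data.Rational.Base as ℚ using (ℚ; 0ℚ; 1ℚ)
import Data.Rational.Properties as ℚₚ
open import Data.Sum.Base using (_⊎_; inj₁; inj₂)
open import Data.Vec.Functional using (Vector)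
open import Relation.Binary.Construct.Closure.ReflexiveTransitive using (Star)
import Relation.Binary.Construct.NonStrictToStrict as NonStrictToStrict
open import Relation.Binary.Definitions using (tri<; tri≈; tri>)
open import Relation.Binary.PropositionalEquality.Core using (_≡_; refl; subst)
open import Relation.Nullary using (¬_; Dec; yes; no)
open import Relation.Unary using (Pred; _∈_)

-- The real numbers, as Dedekind cuts represented by their lower sets.  In the
-- presence of excluded middle this is the classical real line.

record ℝ : Set₁ where
  field
    lower     : Pred ℚ 0ℓ
    inhabited : ∃[ q ] lower q
    bounded   : ∃[ q ] ¬ lower q
    downward  : ∀ {p q} → p ℚ.< q → lower q → lower p
    rounded   : ∀ {q} → lower q → ∃[ r ] q ℚ.< r × lower r

open ℝ public

_≤ℝ_ : ℝ → ℝ → Set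
x ≤ℝ y = ∀ {q} → lower x q → lower y q

r-1<r : ∀ r → r ℚ.+ (ℚ.- 1ℚ) ℚ.< r
r-1<r r = subst (r ℚ.+ (ℚ.- 1ℚ) ℚ.<_) (ℚₚ.+-identityʳ r)
  (ℚₚ.+-monoʳ-< r (ℚₚ.negative⁻¹ (ℚ.- 1ℚ)))

fromℚ : ℚ → ℝ
fromℚ r .lower q    = q ℚ.< r
fromℚ r .inhabited  = r ℚ.+ (ℚ.- 1ℚ) , r-1<r r
fromℚ r .bounded    = r , ℚₚ.<-irrefl refl
fromℚ r .downward   = ℚₚ.<-trans
fromℚ r .rounded q<r with ℚₚ.<-dense q<r
... | m , q<m , m<r = m , q<m , m<r

0≤ℝ1 : fromℚ 0ℚ ≤ℝ fromℚ 1ℚ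
0≤ℝ1 q<0 = ℚₚ.<-trans q<0 (ℚₚ.positive⁻¹ 1ℚ)

-- The unit interval [0,1].

record 𝕀 : Set₁ where
  field
    value   : ℝ
    0≤value : fromℚ 0ℚ ≤ℝ value
    value≤1 : value ≤ℝ fromℚ 1ℚ

open 𝕀 public

infix 4 _≤_ _≈_

-- A record rather than a synonym, so that x and y can be inferred.
record _≤_ (x y : 𝕀) : Set where
  constructor mk≤
  field
    ≤-value : value x ≤ℝ value y

open _≤_ public

_≈_ : 𝕀 → 𝕀 → Set
x ≈ y = x ≤ y × y ≤ x

open NonStrictToStrict _≈_ _≤_ public using (_<_)

𝟎 𝟏 : 𝕀
𝟎 .value   = fromℚ 0ℚ
𝟎 .0≤value = λ q<0 → q<0
𝟎 .value≤1 = 0≤ℝ1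
𝟏 .value   = fromℚ 1ℚ
𝟏 .0≤value = 0≤ℝ1
𝟏 .value≤1 = λ q<1 → q<1

x≤𝟏 : ∀ x → x ≤ 𝟏
x≤𝟏 x = mk≤ (value≤1 x)

infixr 7 _∧_

-- The minimum of two cuts is the intersection of their lower sets.
_∧_ : 𝕀 → 𝕀 → 𝕀
(x ∧ y) .value .lower q = lower (value x) q × lower (value y) q
(x ∧ y) .value .inhabited with inhabited (fromℚ 0ℚ)
... | q , q<0 = q , 0≤value x q<0 , 0≤value y q<0
(x ∧ y) .value .bounded with bounded (value x)
... | q , q∉x = q , λ (q∈x , _) → q∉x q∈x
(x ∧ y) .value .downward p<q (q∈x , q∈y) =
  downward (value x) p<q q∈x , downward (value y) p<q q∈y
(x ∧ y) .value .rounded (q∈x , q∈y)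
  with rounded (value x) q∈x | rounded (value y) q∈y
... | r , q<r , r∈x | s , q<s , s∈y with ℚₚ.<-cmp r s
...   | tri< r<s _ _  = r , q<r , r∈x , downward (value y) r<s s∈y
...   | tri≈ _ refl _ = r , q<r , r∈x , s∈y
...   | tri> _ _ s<r  = s , q<s , downward (value x) s<r r∈x , s∈y
(x ∧ y) .0≤value q<0 = 0≤value x q<0 , 0≤value y q<0
(x ∧ y) .value≤1 (q∈x , _) = value≤1 x q∈x

-- The supremum in [0,1] of an arbitrary family: the union of the lower sets,
-- together with that of 0 (so the supremum of the empty family is 0).
⋁ : {I : Set} → (I → 𝕀) → 𝕀
⋁ x .value .lower q = (q ℚ.< 0ℚ) ⊎ (∃[ i ] lower (value (x i)) q)
⋁ x .value .inhabited with inhabited (fromℚ 0ℚ)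
... | q , q<0 = q , inj₁ q<0
⋁ x .value .bounded = 1ℚ , λ where
  (inj₁ 1<0)       → ℚₚ.<-irrefl refl (0≤ℝ1 1<0)
  (inj₂ (i , 1∈x)) → ℚₚ.<-irrefl refl (value≤1 (x i) 1∈x)
⋁ x .value .downward p<q (inj₁ q<0)       = inj₁ (ℚₚ.<-trans p<q q<0)
⋁ x .value .downward p<q (inj₂ (i , q∈x)) = inj₂ (i , downward (value (x i)) p<q q∈x)
⋁ x .value .rounded (inj₁ q<0) with rounded (fromℚ 0ℚ) q<0
... | r , q<r , r<0 = r , q<r , inj₁ r<0
⋁ x .value .rounded (inj₂ (i , q∈x)) with rounded (value (x i)) q∈x
... | r , q<r , r∈x = r , q<r , inj₂ (i , r∈x)
⋁ x .0≤value q<0 = inj₁ q<0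
⋁ x .value≤1 (inj₁ q<0)       = 0≤ℝ1 q<0
⋁ x .value≤1 (inj₂ (i , q∈x)) = value≤1 (x i) q∈x

FuzzySet : Set → Set₁
FuzzySet X = X → 𝕀

module _ {X : Set} where

  infix 4 _⊆_ _≗_
  infixr 7 _∩_

  _⊆_ : FuzzySet X → FuzzySet X → Set
  A ⊆ B = ∀ x → A x ≤ B x

  _≗_ : FuzzySet X → FuzzySet X → Set
  A ≗ B = ∀ x → A x ≈ B x

  _∩_ : FuzzySet X → FuzzySet X → FuzzySet X
  (A ∩ B) x = A x ∧ B x

  supp : FuzzySet X → Pred X 0ℓ
  supp A x = 𝟎 < A x

Matrix : ℕ → Set₁
Matrix n = Vector (Vector 𝕀 n) n

infixl 8 _∘ᵥ_
infixr 7 _·_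

_∘ᵥ_ : ∀ {n} → Vector 𝕀 n → Matrix n → Vector 𝕀 n
(x ∘ᵥ A) j = ⋁ λ l → x l ∧ A l j

_·_ : ∀ {n} → 𝕀 → Vector 𝕀 n → Vector 𝕀 n
(α · x) i = α ∧ x i

infix 4 _≈ᵥ_ _≈ₘ_ _≈ₛ_

_≈ᵥ_ : ∀ {n} → Vector 𝕀 n → Vector 𝕀 n → Set
x ≈ᵥ y = ∀ i → x i ≈ y i

_≈ₘ_ : ∀ {n} → Matrix n → Matrix n → Set
A ≈ₘ B = ∀ i → A i ≈ᵥ B i

NonZero : ∀ {n} → Vector 𝕀 n → Set
NonZero x = ¬ (x ≈ᵥ λ _ → 𝟎)

State : ℕ → Set₁
State n = Σ (Vector 𝕀 n) NonZero

_≈ₛ_ : ∀ {n} → State n → State n → Set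
p ≈ₛ q = proj₁ p ≈ᵥ proj₁ q

-- A finite set of matrices is given by an enumeration without repetitions.
record FDES (n : ℕ) : Set₁ where
  field
    size             : ℕ
    matrix           : Fin size → Matrix n
    matrix-injective : ∀ {a b} → matrix a ≈ₘ matrix b → a ≡ b
    q₀               : State n

  Event : Set
  Event = Fin size

  String : Set
  String = List Event

-- Excluded middle makes definedness of partial transitions decidable.
module Classical (em : ExcludedMiddle 0ℓ) {n : ℕ} (G : FDES n)
                 (Euc : FuzzySet (FDES.Event G)) where

  open FDES G

  toState : Vector 𝕀 n → Maybe (State n)
  toState x with em {NonZero x}
  ... | yes x≠0 = just (x , x≠0)
  ... | no  _   = nothing

  Transition : Set₁
  Transition = State n → Event → Maybe (State n)

  δ : Transition
  δ (q , _) a = toState (q ∘ᵥ matrix a)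

  extend : Transition → State n → String → Maybe (State n)
  extend t q = foldl (λ m a → m >>= λ p → t p a) (just q)

  generated : Transition → FuzzySet String
  generated t []        = 𝟏
  generated t s@(_ ∷ _) = maybe (λ q → ⋁ (proj₁ q)) 𝟎 (extend t q₀ s)

  𝓛G : FuzzySet String
  𝓛G = generated δ

  -- A controller is a map on states, hence compatible with equality of states.
  record FSFC : Set₁ where
    field
      control      : State n → FuzzySet Event
      control-cong : ∀ {p q} → p ≈ₛ q → control p ≗ control q
      Euc≤control  : ∀ q → Euc ⊆ control q

  module _ (f : FSFC) where
    open FSFC f

    δᶠ : Transition
    δᶠ q a = toState (control q a · (proj₁ q ∘ᵥ matrix a))

    reachable : Pred (State n) (lsuc 0ℓ)
    reachable q = ∃[ s ] Pointwise _≈ₛ_ (extend δᶠ q₀ s) (just q)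

    𝓛Gᶠ : FuzzySet String
    𝓛Gᶠ = generated δᶠ

  record IsFuzzyLanguage₁ (L : FuzzySet String) : Set where
    field
      ε-full        : L [] ≈ 𝟏
      prefix-closed : ∀ s a → L (s ∷ʳ a) ≤ L s

  IsFuzzyLanguage : FuzzySet String → Set
  IsFuzzyLanguage L = (L ≗ λ _ → 𝟎) ⊎ IsFuzzyLanguage₁ L

  infixl 8 _⊙_

  _⊙_ : FuzzySet String → FuzzySet String → FuzzySet String
  (L₁ ⊙ L₂) s = ⋁ {Σ[ (s₁ , s₂) ∈ String × String ] s₁ ++ s₂ ≡ s}
                  λ ((s₁ , s₂) , _) → L₁ s₁ ∧ L₂ s₂

  𝓔uc : FuzzySet String
  𝓔uc []          = 𝟎
  𝓔uc (a ∷ [])    = Euc a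
  𝓔uc (_ ∷ _ ∷ _) = 𝟎

  record ControllableLanguage (K : FuzzySet String) : Set where
    field
      isFuzzyLanguage : IsFuzzyLanguage K
      K⊆𝓛G            : K ⊆ 𝓛G
      controllable    : (K ⊙ 𝓔uc) ∩ 𝓛G ⊆ K

  -- Irrelevance of the membership proof makes the action a function of s only.
  record Supervisor : Set₁ where
    field
      action     : ∀ s → .(s ∈ supp 𝓛G) → FuzzySet Event
      Euc≤action : ∀ s .(s∈supp : s ∈ supp 𝓛G) → Euc ⊆ action s s∈supp

  module _ (S : Supervisor) where
    open Supervisor S

    -- Outside supp 𝓛G, where the action is undefined, 𝓛G (s a) = 0.
    supervisedStep : ∀ s → Dec (s ∈ supp 𝓛G) → Event → 𝕀 → 𝕀
    supervisedStep s (yes s∈supp) a l = 𝓛G (s ∷ʳ a) ∧ action s s∈supp a ∧ l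
    supervisedStep s (no  _)      a l = 𝟎

    supervised : {s : String} → Reverse s → 𝕀
    supervised []             = 𝟏
    supervised (s ∶ rs ∶ʳ a) = supervisedStep s em a (supervised rs)

    𝓛S/G : FuzzySet String
    𝓛S/G s = supervised (reverseView s)

  module _ (f : FSFC) where
    open FSFC f

    inducedAction : Maybe (State n) → FuzzySet Event
    inducedAction (just q) = control q
    inducedAction nothing  = λ _ → 𝟏

    Euc≤inducedAction : ∀ m → Euc ⊆ inducedAction m
    Euc≤inducedAction (just q) = Euc≤control q
    Euc≤inducedAction nothing  = λ a → x≤𝟏 (Euc a)

    inducedSupervisor : Supervisor
    inducedSupervisor = record
      { action     = λ s _ → inducedAction (extend (δᶠ f) q₀ s)
      ; Euc≤action = λ s _ → Euc≤inducedAction (extend (δᶠ f) q₀ s)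
      }

  StateSet : Set₂
  StateSet = Pred (State n) (lsuc 0ℓ)

  Succ : StateSet → State n → Pred (Event × State n) (lsuc 0ℓ)
  Succ P q (a , p) =
    p ∈ P × ∃[ α ] Euc a ≤ α × (α · (proj₁ q ∘ᵥ matrix a)) ≈ᵥ proj₁ p

  record Compatible (P : StateSet) (q : State n)
                    (C : Pred (Event × State n) (lsuc 0ℓ)) : Set₁ where
    field
      C-resp : ∀ {a p p′} → p ≈ₛ p′ → (a , p) ∈ C → (a , p′) ∈ C
      C⊆Succ : ∀ {ap} → ap ∈ C → ap ∈ Succ P q
      C1     : ∀ {a₁ p₁ a₂ p₂} → (a₁ , p₁) ∈ C → (a₂ , p₂) ∈ C →
               a₁ ≡ a₂ → p₁ ≈ₛ p₂
      C2     : ∀ a → 𝟎 < Euc a → NonZero (proj₁ q ∘ᵥ matrix a) →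
               ∃[ p ] p ∈ P × (a , p) ∈ C

  -- The selection q ↦ C q is a map on P, hence compatible with equality of
  -- states; its values outside P are immaterial.  Paths end at p up to ≈ₛ.
  record ControllableStateSet (P : StateSet) : Set₂ where
    field
      C            : State n → Pred (Event × State n) (lsuc 0ℓ)
      C-cong       : ∀ {q q′} → q ∈ P → q ≈ₛ q′ → ∀ {ap} → ap ∈ C q → ap ∈ C q′
      C-compatible : ∀ {q} → q ∈ P → Compatible P q (C q)
      C-reaches    : ∀ {p} → p ∈ P →
        ∃[ p′ ] Star (λ q q′ → q ∈ P × ∃[ a ] (a , q′) ∈ C q) q₀ p′ × p′ ≈ₛ p

{-# OPTIONS --safe #-}

-- Scalars pass through max-min composition, (λ · x) ∘ A = λ · (x ∘ A), so the
-- closed loop only attenuates: δᶠ(q₀, s) = λ · δ(q₀, s), where λ is the minimum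
-- of the control degrees met along s.  Taking largest entries gives
-- 𝓛Gᶠ(s) = λ ∧ 𝓛G(s), hence 𝓛Gᶠ(s a) = 𝓛G(s a) ∧ α ∧ 𝓛Gᶠ(s) with α the control
-- degree of a after s.  This is the recursion defining 𝓛S/G, and controllability
-- follows from Euc(a) ≤ α.

module Submission where

open import Defs
open import Level using (0ℓ; suc)
open import Axiom.ExcludedMiddle using (ExcludedMiddle)
open import Data.Fin.Base using (Fin)
open import Data.List.Base using ([]; _∷_; _∷ʳ_)
open import Data.List.Properties using (foldl-∷ʳ)
open import Data.List.Reverse using (Reverse; []; _∶_∶ʳ_; reverseView)
open import Data.Maybe.Base using (Maybe; just; nothing; maybe; _>>=_)
open import Data.Nat.Base as ℕ using (ℕ)
open import Data.Product.Base using (∃-syntax; _×_; _,_; proj₁; proj₂; swap)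
open import Data.Sum.Base using (inj₁; inj₂)
open import Data.Vec.Functional using (Vector)
open import Relation.Binary.Bundles using (Poset)
open import Relation.Binary.Definitions using (_Respects_)
open import Relation.Binary.PropositionalEquality.Core using (_≡_; refl; cong)
import Relation.Binary.Reasoning.PartialOrder as PosetReasoning
open import Relation.Nullary using (¬_; yes; no)
open import Relation.Nullary.Decidable.Core using (decidable-stable)
open import Relation.Unary using (_≐_; _∈_)

-- Order, meets and joins in the unit interval.

≤-refl : ∀ {x} → x ≤ x
≤-refl = mk≤ λ q∈x → q∈x

≤-trans : ∀ {x y z} → x ≤ y → y ≤ z → x ≤ z
≤-trans x≤y y≤z = mk≤ λ q∈x → ≤-value y≤z (≤-value x≤y q∈x)

𝟎≤x : ∀ x → 𝟎 ≤ x
𝟎≤x x = mk≤ (0≤value x)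

𝕀-poset : Poset (suc 0ℓ) 0ℓ 0ℓ
𝕀-poset = record
  { Carrier = 𝕀 ; _≈_ = _≈_ ; _≤_ = _≤_
  ; isPartialOrder = record
    { isPreorder = record
      { isEquivalence = record
        { refl  = ≤-refl , ≤-refl
        ; sym   = swap
        ; trans = λ (x≤y , y≤x) (y≤z , z≤y) → ≤-trans x≤y y≤z , ≤-trans z≤y y≤x
        }
      ; reflexive = proj₁
      ; trans     = ≤-trans
      }
    ; antisym = _,_
    }
  }

open Poset 𝕀-poset using (module Eq)
open PosetReasoning 𝕀-poset

x≤𝟎⇒x≈𝟎 : ∀ {x} → x ≤ 𝟎 → x ≈ 𝟎
x≤𝟎⇒x≈𝟎 x≤𝟎 = x≤𝟎 , 𝟎≤x _

x∧y≤x : ∀ x y → x ∧ y ≤ x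
x∧y≤x x y = mk≤ proj₁

x∧y≤y : ∀ x y → x ∧ y ≤ y
x∧y≤y x y = mk≤ proj₂

∧-assoc : ∀ x y z → (x ∧ y) ∧ z ≈ x ∧ y ∧ z
∧-assoc x y z =
  mk≤ (λ ((q∈x , q∈y) , q∈z) → q∈x , q∈y , q∈z) ,
  mk≤ (λ (q∈x , q∈y , q∈z) → (q∈x , q∈y) , q∈z)

-- Arguments of ∧ and ⋁ are explicit because 𝕀 has η: Agda compares meets and joins
-- field by field instead of inverting ∧ and ⋁.  With a literal 𝟏 among the arguments
-- this unfolds proofs about ℚ and is prohibitively slow, so vector-δᶠ and
-- attenuated-[] below take a variable in its place.
y≤x⇒x∧y≈y : ∀ x y → y ≤ x → x ∧ y ≈ y
y≤x⇒x∧y≈y x y y≤x = mk≤ proj₂ , mk≤ λ q∈y → ≤-value y≤x q∈y , q∈y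

≤𝟎⇒≈-∧ : ∀ x α y → x ≤ 𝟎 → y ≤ 𝟎 → x ≈ α ∧ y
≤𝟎⇒≈-∧ x α y x≤𝟎 y≤𝟎 = ≤-trans x≤𝟎 (𝟎≤x (α ∧ y)) , ≤-trans (x∧y≤y α y) (≤-trans y≤𝟎 (𝟎≤x x))

∧-cong : ∀ x y u v → x ≈ y → u ≈ v → x ∧ u ≈ y ∧ v
∧-cong x y u v (x≤y , y≤x) (u≤v , v≤u) =
  (mk≤ λ (q∈x , q∈u) → ≤-value x≤y q∈x , ≤-value u≤v q∈u) ,
  (mk≤ λ (q∈y , q∈v) → ≤-value y≤x q∈y , ≤-value v≤u q∈v)

∧-congˡ : ∀ x y z → y ≈ z → x ∧ y ≈ x ∧ z
∧-congˡ x y z = ∧-cong x x y z Eq.refl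

module _ {I : Set} where

  ⋁-upper : ∀ (x : I → 𝕀) i → x i ≤ ⋁ x
  ⋁-upper x i = mk≤ λ q∈x → inj₂ (i , q∈x)

  ⋁-least : ∀ (x : I → 𝕀) {y} → (∀ i → x i ≤ y) → ⋁ x ≤ y
  ⋁-least x {y} x≤y = mk≤ λ where
    (inj₁ q<0)       → 0≤value y q<0
    (inj₂ (i , q∈x)) → ≤-value (x≤y i) q∈x

  ⋁-monotonic : ∀ (x y : I → 𝕀) → (∀ i → x i ≤ y i) → ⋁ x ≤ ⋁ y
  ⋁-monotonic x y x≤y = ⋁-least x λ i → ≤-trans (x≤y i) (⋁-upper y i)

  ⋁-cong : ∀ (x y : I → 𝕀) → (∀ i → x i ≈ y i) → ⋁ x ≈ ⋁ y
  ⋁-cong x y x≈y =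
    ⋁-monotonic x y (λ i → proj₁ (x≈y i)) , ⋁-monotonic y x (λ i → proj₂ (x≈y i))

  -- On lower sets this is intersection distributing over union. The negative rationals adjoined by
  -- `⋁` cause no trouble, as they lie in the lower set of every `α`.
  ∧-distribˡ-⋁ : ∀ α (x : I → 𝕀) → α ∧ ⋁ x ≈ ⋁ λ i → α ∧ x i
  ∧-distribˡ-⋁ α x =
    (mk≤ λ where
      (_   , inj₁ q<0)       → inj₁ q<0
      (q∈α , inj₂ (i , q∈x)) → inj₂ (i , q∈α , q∈x)) ,
    (mk≤ λ where
      (inj₁ q<0)             → 0≤value α q<0 , inj₁ q<0
      (inj₂ (i , q∈α , q∈x)) → q∈α , inj₂ (i , q∈x))

  -- Reduces controllability to a check on each factorisation of a string.
  ⋁-∧-least : ∀ (x : I → 𝕀) y {z} → (∀ i → x i ∧ y ≤ z) → ⋁ x ∧ y ≤ z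
  ⋁-∧-least x y {z} x∧y≤z = mk≤ λ where
    (inj₁ q<0       , _)   → 0≤value z q<0
    (inj₂ (i , q∈x) , q∈y) → ≤-value (x∧y≤z i) (q∈x , q∈y)

-- Max-min composition and scalars.

module _ {n : ℕ} where

  ∘ᵥ-cong : ∀ (x y : Vector 𝕀 n) (A : Matrix n) → x ≈ᵥ y → x ∘ᵥ A ≈ᵥ y ∘ᵥ A
  ∘ᵥ-cong x y A x≈y j = ⋁-cong (λ l → x l ∧ A l j) (λ l → y l ∧ A l j) λ l →
    (mk≤ λ (q∈x , q∈A) → ≤-value (proj₁ (x≈y l)) q∈x , q∈A) ,
    (mk≤ λ (q∈y , q∈A) → ≤-value (proj₂ (x≈y l)) q∈y , q∈A)

  ·-∘ᵥ-assoc : ∀ α (x : Vector 𝕀 n) (A : Matrix n) → (α · x) ∘ᵥ A ≈ᵥ α · (x ∘ᵥ A)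
  ·-∘ᵥ-assoc α x A j = begin-equality
    (⋁ λ l → (α ∧ x l) ∧ A l j) ≈⟨ ⋁-cong (λ l → (α ∧ x l) ∧ A l j) (λ l → α ∧ x l ∧ A l j)
                                     (λ l → ∧-assoc α (x l) (A l j)) ⟩
    (⋁ λ l → α ∧ x l ∧ A l j)   ≈⟨ ∧-distribˡ-⋁ α (λ l → x l ∧ A l j) ⟨
    α ∧ (x ∘ᵥ A) j              ∎

  -- Each term of the composition is capped by an entry of `x`; hence no event can raise the largest
  -- entry of a state.
  ∘ᵥ-≤-⋁ : ∀ (x : Vector 𝕀 n) (A : Matrix n) j → (x ∘ᵥ A) j ≤ ⋁ x
  ∘ᵥ-≤-⋁ x A j = ⋁-monotonic (λ l → x l ∧ A l j) x λ l → x∧y≤x (x l) (A l j)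

  𝟎-∘ᵥ : ∀ (x : Vector 𝕀 n) (A : Matrix n) → (∀ l → x l ≤ 𝟎) → ∀ j → (x ∘ᵥ A) j ≈ 𝟎
  𝟎-∘ᵥ x A x≤𝟎 j = x≤𝟎⇒x≈𝟎
    (⋁-least (λ l → x l ∧ A l j) λ l → ≤-trans (x∧y≤x (x l) (A l j)) (x≤𝟎 l))

  -- An undefined state is represented by the zero vector.
  vector : Maybe (State n) → Vector 𝕀 n
  vector = maybe proj₁ (λ _ → 𝟎)

module Attenuation (em : ExcludedMiddle 0ℓ) {n : ℕ} (G : FDES n)
                   (Euc : FuzzySet (FDES.Event G)) where

  open FDES G
  open Classical em G Euc

  -- Runs as total vectors, and the language of the plant.

  ∉supp⇒≈𝟎 : ∀ {X : Set} (A : FuzzySet X) {x} → ¬ x ∈ supp A → A x ≈ 𝟎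
  ∉supp⇒≈𝟎 A {x} x∉supp =
    decidable-stable em λ Ax≉𝟎 → x∉supp (𝟎≤x (A x) , λ 𝟎≈Ax → Ax≉𝟎 (swap 𝟎≈Ax))

  -- Makes the partial transitions total: `toState` rejects only vectors that are not nonzero, and
  -- excluded middle turns this double negation into being zero, which is what `vector` returns.
  vector-toState : ∀ x → vector (toState x) ≈ᵥ x
  vector-toState x i with em {NonZero x}
  ... | yes _   = Eq.refl
  ... | no  x≈0 = Eq.sym (decidable-stable em x≈0 i)

  run : Transition → String → Vector 𝕀 n
  run t s = vector (extend t q₀ s)

  extend-∷ʳ : ∀ t s a → extend t q₀ (s ∷ʳ a) ≡ (extend t q₀ s >>= λ q → t q a)
  extend-∷ʳ t s a = foldl-∷ʳ _ (just q₀) a s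

  -- The default `𝟎` for an undefined state is the join of the zero vector.
  generated-∷ : ∀ t a s → generated t (a ∷ s) ≈ ⋁ (run t (a ∷ s))
  generated-∷ t a s with extend t q₀ (a ∷ s)
  ... | just _  = Eq.refl
  ... | nothing = Eq.sym (x≤𝟎⇒x≈𝟎 (⋁-least {I = Fin n} (λ _ → 𝟎) λ _ → ≤-refl))

  generated-∷ʳ : ∀ t s a → generated t (s ∷ʳ a) ≈ ⋁ (run t (s ∷ʳ a))
  -- The split on `s` only exposes the first event, on which `generated` branches.
  generated-∷ʳ t []      a = generated-∷ t a []
  generated-∷ʳ t (b ∷ s) a = generated-∷ t b (s ∷ʳ a)

  -- At the empty string the inequality may be strict: ⋁ q₀ need not be 1.
  ⋁-run≤generated : ∀ t s → ⋁ (run t s) ≤ generated t s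
  ⋁-run≤generated t []      = x≤𝟏 _
  ⋁-run≤generated t (a ∷ s) = proj₂ (generated-∷ t a s)

  -- Composition keeps the zero vector at zero, just as an undefined state stays undefined.
  vector-δ : ∀ m a → vector (m >>= λ q → δ q a) ≈ᵥ vector m ∘ᵥ matrix a
  vector-δ (just (q , _)) a = vector-toState (q ∘ᵥ matrix a)
  vector-δ nothing        a = λ i → Eq.sym (𝟎-∘ᵥ (vector nothing) (matrix a) (λ _ → ≤-refl) i)

  run-δ-∷ʳ : ∀ s a → run δ (s ∷ʳ a) ≈ᵥ run δ s ∘ᵥ matrix a
  run-δ-∷ʳ s a i = begin-equality
    run δ (s ∷ʳ a) i                           ≡⟨ cong (λ m → vector m i) (extend-∷ʳ δ s a) ⟩
    vector (extend δ q₀ s >>= λ q → δ q a) i   ≈⟨ vector-δ (extend δ q₀ s) a i ⟩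
    (run δ s ∘ᵥ matrix a) i                    ∎

  𝓛G-prefix-closed : ∀ s a → 𝓛G (s ∷ʳ a) ≤ 𝓛G s
  𝓛G-prefix-closed s a = begin
    𝓛G (s ∷ʳ a)             ≈⟨ generated-∷ʳ δ s a ⟩
    ⋁ (run δ (s ∷ʳ a))      ≈⟨ ⋁-cong (run δ (s ∷ʳ a)) (run δ s ∘ᵥ matrix a)
                                 (run-δ-∷ʳ s a) ⟩
    ⋁ (run δ s ∘ᵥ matrix a) ≤⟨ ⋁-least (run δ s ∘ᵥ matrix a) (∘ᵥ-≤-⋁ (run δ s) (matrix a)) ⟩
    ⋁ (run δ s)             ≤⟨ ⋁-run≤generated δ s ⟩
    𝓛G s                    ∎

  -- The closed loop as an attenuation of the plant.

  module _ (f : FSFC) where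

    -- Definitionally the action of `inducedSupervisor`. The default `𝟏` after an undefined run does
    -- no harm, since it multiplies a zero vector.
    degree : String → Event → 𝕀
    degree s = inducedAction f (extend (δᶠ f) q₀ s)

    vector-δᶠ : ∀ m a α → (∀ q → m ≡ just q → FSFC.control f q a ≈ α) →
      vector (m >>= λ q → δᶠ f q a) ≈ᵥ α · (vector m ∘ᵥ matrix a)
    vector-δᶠ (just q) a α control≈α i = Eq.trans
      (vector-toState (FSFC.control f q a · (proj₁ q ∘ᵥ matrix a)) i)
      (∧-cong (FSFC.control f q a) α
              ((proj₁ q ∘ᵥ matrix a) i) ((vector (just q) ∘ᵥ matrix a) i)
              (control≈α q refl)
              (∘ᵥ-cong (proj₁ q) (vector (just q)) (matrix a) (λ _ → Eq.refl) i))
    vector-δᶠ nothing  a α _         i =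
      ≤𝟎⇒≈-∧ (vector {n} nothing i) α ((vector {n} nothing ∘ᵥ matrix a) i) ≤-refl
        (proj₁ (𝟎-∘ᵥ (vector nothing) (matrix a) (λ _ → ≤-refl) i))

    control≈inducedAction : ∀ m a q → m ≡ just q → FSFC.control f q a ≈ inducedAction f m a
    control≈inducedAction (just q) a q refl = Eq.refl

    run-δᶠ-∷ʳ : ∀ s a →
      run (δᶠ f) (s ∷ʳ a) ≈ᵥ degree s a · (run (δᶠ f) s ∘ᵥ matrix a)
    run-δᶠ-∷ʳ s a i = begin-equality
      run (δᶠ f) (s ∷ʳ a) i                 ≡⟨ cong (λ m → vector m i) (extend-∷ʳ (δᶠ f) s a) ⟩
      vector (extend (δᶠ f) q₀ s >>= λ q → δᶠ f q a) i
                                            ≈⟨ vector-δᶠ (extend (δᶠ f) q₀ s) a (degree s a)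
                                                 (control≈inducedAction (extend (δᶠ f) q₀ s) a) i ⟩
      degree s a ∧ (run (δᶠ f) s ∘ᵥ matrix a) i ∎

    -- The second field is not a consequence of the first at the empty string, where `generated` is
    -- `𝟏` by convention rather than the largest entry of `q₀`.
    record Attenuated (s : String) (ƛ : 𝕀) : Set where
      field
        run-≈ : run (δᶠ f) s ≈ᵥ ƛ · run δ s
        𝓛-≈   : 𝓛Gᶠ f s ≈ ƛ ∧ 𝓛G s

    open Attenuated

    attenuated-[] : ∀ ƛ → 𝟏 ≤ ƛ → Attenuated [] ƛ
    attenuated-[] ƛ 𝟏≤ƛ = record
      { run-≈ = λ i → Eq.sym (y≤x⇒x∧y≈y ƛ (run δ [] i) (≤-trans (x≤𝟏 (run δ [] i)) 𝟏≤ƛ))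
      ; 𝓛-≈   = mk≤ (λ q<1 → ≤-value 𝟏≤ƛ q<1 , q<1) , mk≤ proj₂
      }

    attenuated-∷ʳ : ∀ s ƛ a → Attenuated s ƛ → Attenuated (s ∷ʳ a) (degree s a ∧ ƛ)
    attenuated-∷ʳ s ƛ a att = record { run-≈ = run-≈′ ; 𝓛-≈ = 𝓛-≈′ }
      where
      run-≈′ : run (δᶠ f) (s ∷ʳ a) ≈ᵥ (degree s a ∧ ƛ) · run δ (s ∷ʳ a)
      run-≈′ i = begin-equality
        run (δᶠ f) (s ∷ʳ a) i                        ≈⟨ run-δᶠ-∷ʳ s a i ⟩
        degree s a ∧ (run (δᶠ f) s ∘ᵥ matrix a) i    ≈⟨ ∧-congˡ (degree s a) _ _
          (∘ᵥ-cong (run (δᶠ f) s) (ƛ · run δ s) (matrix a) (run-≈ att) i) ⟩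
        degree s a ∧ ((ƛ · run δ s) ∘ᵥ matrix a) i   ≈⟨ ∧-congˡ (degree s a) _ _
          (·-∘ᵥ-assoc ƛ (run δ s) (matrix a) i) ⟩
        degree s a ∧ ƛ ∧ (run δ s ∘ᵥ matrix a) i     ≈⟨ ∧-assoc (degree s a) ƛ ((run δ s ∘ᵥ matrix a) i) ⟨
        (degree s a ∧ ƛ) ∧ (run δ s ∘ᵥ matrix a) i   ≈⟨ ∧-congˡ (degree s a ∧ ƛ) _ _ (run-δ-∷ʳ s a i) ⟨
        (degree s a ∧ ƛ) ∧ run δ (s ∷ʳ a) i          ∎

      𝓛-≈′ : 𝓛Gᶠ f (s ∷ʳ a) ≈ (degree s a ∧ ƛ) ∧ 𝓛G (s ∷ʳ a)
      𝓛-≈′ = begin-equality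
        𝓛Gᶠ f (s ∷ʳ a)                             ≈⟨ generated-∷ʳ (δᶠ f) s a ⟩
        ⋁ (run (δᶠ f) (s ∷ʳ a))                    ≈⟨ ⋁-cong (run (δᶠ f) (s ∷ʳ a))
          ((degree s a ∧ ƛ) · run δ (s ∷ʳ a)) run-≈′ ⟩
        ⋁ ((degree s a ∧ ƛ) · run δ (s ∷ʳ a))      ≈⟨ ∧-distribˡ-⋁ (degree s a ∧ ƛ) (run δ (s ∷ʳ a)) ⟨
        (degree s a ∧ ƛ) ∧ ⋁ (run δ (s ∷ʳ a))      ≈⟨ ∧-congˡ (degree s a ∧ ƛ) _ _ (generated-∷ʳ δ s a) ⟨
        (degree s a ∧ ƛ) ∧ 𝓛G (s ∷ʳ a)             ∎

    attenuated : ∀ {s} → Reverse s → ∃[ ƛ ] Attenuated s ƛ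
    attenuated []            = 𝟏 , attenuated-[] 𝟏 ≤-refl
    attenuated (s ∶ rs ∶ʳ a) with attenuated rs
    ... | ƛ , att = degree s a ∧ ƛ , attenuated-∷ʳ s ƛ a att

    𝓛Gᶠ⊆𝓛G : 𝓛Gᶠ f ⊆ 𝓛G
    𝓛Gᶠ⊆𝓛G s with attenuated (reverseView s)
    ... | ƛ , att = ≤-trans (proj₁ (𝓛-≈ att)) (x∧y≤y ƛ (𝓛G s))

    𝓛Gᶠ-∷ʳ : ∀ s a → 𝓛Gᶠ f (s ∷ʳ a) ≈ 𝓛G (s ∷ʳ a) ∧ degree s a ∧ 𝓛Gᶠ f s
    𝓛Gᶠ-∷ʳ s a with attenuated (reverseView s)
    ... | ƛ , att = begin-equality
      𝓛Gᶠ f (s ∷ʳ a)                        ≈⟨ 𝓛-≈ (attenuated-∷ʳ s ƛ a att) ⟩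
      (degree s a ∧ ƛ) ∧ 𝓛G (s ∷ʳ a)        ≈⟨ rearrange ⟩
      𝓛G (s ∷ʳ a) ∧ degree s a ∧ ƛ ∧ 𝓛G s   ≈⟨ ∧-congˡ (𝓛G (s ∷ʳ a)) _ _
        (∧-congˡ (degree s a) _ _ (𝓛-≈ att)) ⟨
      𝓛G (s ∷ʳ a) ∧ degree s a ∧ 𝓛Gᶠ f s    ∎
      where
      rearrange : (degree s a ∧ ƛ) ∧ 𝓛G (s ∷ʳ a) ≈ 𝓛G (s ∷ʳ a) ∧ degree s a ∧ ƛ ∧ 𝓛G s
      rearrange =
        -- The surplus factor `𝓛G s` is absorbed because it lies above `𝓛G (s ∷ʳ a)`.
        (mk≤ λ ((q∈α , q∈ƛ) , q∈sa) →
          q∈sa , q∈α , q∈ƛ , ≤-value (𝓛G-prefix-closed s a) q∈sa) ,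
        (mk≤ λ (q∈sa , q∈α , q∈ƛ , _) → (q∈α , q∈ƛ) , q∈sa)

    -- Controllability and the induced supervisor.

    𝓛Gᶠ-prefix-closed : ∀ s a → 𝓛Gᶠ f (s ∷ʳ a) ≤ 𝓛Gᶠ f s
    𝓛Gᶠ-prefix-closed s a =
      ≤-trans (proj₁ (𝓛Gᶠ-∷ʳ s a)) (mk≤ λ (_ , _ , q∈s) → q∈s)

    𝓛Gᶠ-uncontrollable : ∀ s a → (𝓛Gᶠ f s ∧ Euc a) ∧ 𝓛G (s ∷ʳ a) ≤ 𝓛Gᶠ f (s ∷ʳ a)
    𝓛Gᶠ-uncontrollable s a =
      ≤-trans (mk≤ λ ((q∈s , q∈a) , q∈sa) → q∈sa , ≤-value Euc≤degree q∈a , q∈s)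
              (proj₂ (𝓛Gᶠ-∷ʳ s a))
      where
      Euc≤degree : Euc a ≤ degree s a
      Euc≤degree = Euc≤inducedAction f (extend (δᶠ f) q₀ s) a

    𝓛Gᶠ-controllable : ControllableLanguage (𝓛Gᶠ f)
    𝓛Gᶠ-controllable = record
      { isFuzzyLanguage = inj₂ record
        { ε-full        = Eq.refl
        ; prefix-closed = 𝓛Gᶠ-prefix-closed
        }
      ; K⊆𝓛G         = 𝓛Gᶠ⊆𝓛G
      ; controllable = λ s → ⋁-∧-least _ (𝓛G s) λ where
          -- `𝓔uc` vanishes off single events, so only the middle case has content.
          ((_  , [])        , _)    → mk≤ λ ((_ , q<0) , _) → 0≤value (𝓛Gᶠ f s) q<0
          ((s₁ , a ∷ [])    , refl) → 𝓛Gᶠ-uncontrollable s₁ a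
          ((_  , _ ∷ _ ∷ _) , _)    → mk≤ λ ((_ , q<0) , _) → 0≤value (𝓛Gᶠ f s) q<0
      }

    -- Induction on the last event: both languages obey the same recursion.
    supervised≈𝓛Gᶠ : ∀ {s} (rs : Reverse s) →
      supervised (inducedSupervisor f) rs ≈ 𝓛Gᶠ f s
    supervised≈𝓛Gᶠ []            = Eq.refl
    supervised≈𝓛Gᶠ (s ∶ rs ∶ʳ a) with em {s ∈ supp 𝓛G}
    ... | yes _ = begin-equality
      𝓛G (s ∷ʳ a) ∧ degree s a ∧ supervised (inducedSupervisor f) rs
        ≈⟨ ∧-congˡ (𝓛G (s ∷ʳ a)) _ _ (∧-congˡ (degree s a) _ _ (supervised≈𝓛Gᶠ rs)) ⟩
      𝓛G (s ∷ʳ a) ∧ degree s a ∧ 𝓛Gᶠ f s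
        ≈⟨ 𝓛Gᶠ-∷ʳ s a ⟨
      𝓛Gᶠ f (s ∷ʳ a) ∎
    -- Here the supervised language is `𝟎` by definition; the closed loop lies below the plant,
    -- which is already zero at `s`.
    ... | no s∉supp = Eq.sym (x≤𝟎⇒x≈𝟎 (begin
      𝓛Gᶠ f (s ∷ʳ a) ≤⟨ 𝓛Gᶠ⊆𝓛G (s ∷ʳ a) ⟩
      𝓛G (s ∷ʳ a)    ≤⟨ 𝓛G-prefix-closed s a ⟩
      𝓛G s           ≈⟨ ∉supp⇒≈𝟎 𝓛G {s} s∉supp ⟩
      𝟎              ∎))

theorem3 : (em : ExcludedMiddle 0ℓ) (n : ℕ) → 1 ℕ.≤ n →
    (G : FDES n) (Euc : FuzzySet (FDES.Event G)) →
    let open Classical em G Euc in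
    (P : StateSet) → P Respects _≈ₛ_ → ControllableStateSet P →
    (f : FSFC) → reachable f ≐ P →
    ControllableLanguage (𝓛Gᶠ f) × 𝓛S/G (inducedSupervisor f) ≗ 𝓛Gᶠ f
theorem3 em n _ G Euc _ _ _ f _ =
  𝓛Gᶠ-controllable f , λ s → supervised≈𝓛Gᶠ f (reverseView s)
  where open Attenuation em G Euc
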